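{- For every integer $n\geq 1$, $$A_{O>N}(n)-B_{O>N}(n)=H'_{ON}(n).$$
   Context: A partition of $n$ is a finite non-increasing sequence of positive integers (its parts) with sum $n$. An overpartition of $n$ is a partition of $n$ in which the first occurrence of each number may be overlined (so for each size $t$ at most one part of size $t$ is overlined); the size of a part $t$ or $\overline{t}$ is $t$, and the weight is the sum of sizes. For an overpartition $\pi$, let $LN(\pi)$ (resp. $SN(\pi)$) be the size of the largest (resp. smallest) non-overlined part of $\pi$ if $\pi$ has non-overlined parts, and $LN(\pi)=0$ (resp. $SN(\pi)=0$) otherwise. Let $LO(\pi)$ be the size of the largest overlined part of $\pi$ if $\pi$ has overlined parts, and $LO(\pi)=0$ otherwise. Let $\ell_{O>N}(\pi)$ be the number of overlined parts of $\pi$ of size greater than $SN(\pi)$. $A_{O>N}(n)$ (resp. $B_{O>N}(n)$) is the number of overpartitions $\pi$ of $n$ such that $SN(\pi)\geq 1$ and $\ell_{O>N}(\pi)$ is even (resp. odd). $\mathcal{E}_O^{N}$ is the set of overpartitions in which non-overlined parts must appear and the sizes of non-overlined parts are greater than or equal to those of overlined parts, i.e. $SN(\pi)\geq 1$ and $SN(\pi)\geq LO(\pi)$. $H'_{ON}(n)$ is the number of overpartitions $\pi$ of $n$ in $\mathcal{E}_O^{N}$ with $LN(\pi)=SN(\pi)$. -}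

module Defs where

open import Data.Bool using (Bool; true; false)
import Data.Bool.Properties as Bool
open import Data.List
  using (List; []; _∷_; map; filter; length; upTo; cartesianProductWith)
open import Data.List.Extrema.Nat using (max; min)
open import Data.List.Membership.Propositional using (_∈_)
open import Data.List.Membership.Propositional.Properties
  using ( ∈-cartesianProductWith⁺; ∈-cartesianProductWith⁻; ∈-upTo⁺
        ; ∈-filter⁺; ∈-filter⁻)
open import Data.List.Properties using (∷-injective)
open import Data.List.Relation.Unary.All using (All; []; _∷_; all?)
import Data.List.Relation.Unary.All as All
open import Data.List.Relation.Unary.AllPairs using (AllPairs; []; _∷_; allPairs?)
open import Data.List.Relation.Unary.Any using (here; there)
open import Data.List.Relation.Unary.Linked using (Linked; linked?)
open import Data.List.Relation.Unary.Unique.Propositional using (Unique)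
import Data.List.Relation.Unary.Unique.Propositional.Properties as Unique
open import Data.Nat using (ℕ; zero; suc; _≤_; _≥_; z≤n; s≤s)
open import Data.Nat.Divisibility using (_∣?_)
open import Data.Nat.ListAction using (sum)
open import Data.Nat.Properties
  using (_≤?_; _<?_; _≥?_; _≟_; ≤-trans; ≤-reflexive; m≤m+n; m≤n+m; +-mono-≤)
open import Data.Product using (_×_; _,_; proj₂)
open import Function using (_⇔_; mk⇔)
open import Relation.Binary.PropositionalEquality using (_≡_; refl)
open import Relation.Nullary using (¬_; ¬?; _×-dec_; _→-dec_)
open import Relation.Nullary.Decidable using (map′)
open import Relation.Unary using (Pred; Decidable)
open import Level using (0ℓ)

record Part : Set where
  constructor part
  field
    size      : ℕ
    overlined : Bool

open Part public

record IsOverpartition (n : ℕ) (π : List Part) : Set where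
  field
    positive      : All (λ p → 1 ≤ size p) π
    nonincreasing : Linked (λ p q → size p ≥ size q) π
    -- AllPairs relates every part p to every part q occurring after it, so
    -- this says that only the first occurrence of a size can be overlined.
    firstOnly     : AllPairs (λ p q → size p ≡ size q → overlined q ≡ false) π
    weight        : sum (map size π) ≡ n

overlinedSizes : List Part → List ℕ
overlinedSizes π = map size (filter (λ p → overlined p Bool.≟ true) π)

nonOverlinedSizes : List Part → List ℕ
nonOverlinedSizes π = map size (filter (λ p → overlined p Bool.≟ false) π)

largest : List ℕ → ℕ
largest = max 0

smallest : List ℕ → ℕ
smallest []       = 0
smallest (x ∷ xs) = min x xs

LN SN LO : List Part → ℕ
LN π = largest  (nonOverlinedSizes π)
SN π = smallest (nonOverlinedSizes π)
LO π = largest  (overlinedSizes π)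

ℓ-O>N : List Part → ℕ
ℓ-O>N π = length (filter (λ t → SN π <? t) (overlinedSizes π))

𝓔-ON : Pred (List Part) 0ℓ
𝓔-ON π = SN π ≥ 1 × SN π ≥ LO π

𝓔-ON? : Decidable 𝓔-ON
𝓔-ON? π = (SN π ≥? 1) ×-dec (SN π ≥? LO π)

isOverpartition? : ∀ n → Decidable (IsOverpartition n)
isOverpartition? n π = map′
  (λ (a , b , c , d) → record
    { positive = a ; nonincreasing = b ; firstOnly = c ; weight = d })
  (λ r → let open IsOverpartition r in positive , nonincreasing , firstOnly , weight)
  (      all? (λ p → 1 ≤? size p) π
   ×-dec linked? (λ p q → size p ≥? size q) π
   ×-dec allPairs? (λ p q → (size p ≟ size q) →-dec (overlined q Bool.≟ false)) π
   ×-dec (sum (map size π) ≟ n))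

-- All lists over the given alphabet of length at most k.
words : ∀ {A : Set} → List A → ℕ → List (List A)
words as zero    = [] ∷ []
words as (suc k) = [] ∷ cartesianProductWith _∷_ as (words as k)

partsUpTo : ℕ → List Part
partsUpTo n = cartesianProductWith part (upTo (suc n)) (false ∷ true ∷ [])

-- An overpartition of n has at most n parts, each of size at most n, so
-- this list misses none; see ∈-overpartitions and overpartitions-unique.
overpartitions : ℕ → List (List Part)
overpartitions n = filter (isOverpartition? n) (words (partsUpTo n) n)

count : {P : Pred (List Part) 0ℓ} → Decidable P → ℕ → ℕ
count P? n = length (filter P? (overpartitions n))

A-O>N B-O>N H′-ON : ℕ → ℕ
A-O>N = count (λ π → (SN π ≥? 1) ×-dec (2 ∣? ℓ-O>N π))
B-O>N = count (λ π → (SN π ≥? 1) ×-dec ¬? (2 ∣? ℓ-O>N π))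
H′-ON = count (λ π → 𝓔-ON? π ×-dec (LN π ≟ SN π))

private
  ∈-words : ∀ {A : Set} {as w : List A} k →
            All (_∈ as) w → length w ≤ k → w ∈ words as k
  ∈-words zero    []       _         = here refl
  ∈-words (suc k) []       _         = here refl
  ∈-words (suc k) (p ∷ ps) (s≤s len) =
    there (∈-cartesianProductWith⁺ _∷_ p (∈-words k ps len))

  words-unique : ∀ {A : Set} {as : List A} k → Unique as → Unique (words as k)
  words-unique zero    u = [] ∷ []
  words-unique {as = as} (suc k) u =
    All.tabulate nonempty ∷ Unique.cartesianProductWith⁺ _∷_ ∷-injective u (words-unique k u)
    where
    nonempty : ∀ {w} → w ∈ cartesianProductWith _∷_ as (words as k) → ¬ [] ≡ w
    nonempty w∈ refl with ∈-cartesianProductWith⁻ _∷_ as (words as k) w∈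
    ... | _ , _ , _ , _ , ()

  ∈-bools : ∀ b → b ∈ false ∷ true ∷ []
  ∈-bools false = here refl
  ∈-bools true  = there (here refl)

  partsUpTo-unique : ∀ n → Unique (partsUpTo n)
  partsUpTo-unique n = Unique.cartesianProductWith⁺ part (λ { refl → refl , refl })
    (Unique.upTo⁺ (suc n)) (((λ ()) ∷ []) ∷ [] ∷ [])

  parts-bounded : ∀ {n} π → sum (map size π) ≤ n → All (_∈ partsUpTo n) π
  parts-bounded []      _  = []
  parts-bounded (p ∷ π) le =
    ∈-cartesianProductWith⁺ part (∈-upTo⁺ (s≤s (≤-trans (m≤m+n _ _) le))) (∈-bools _)
    ∷ parts-bounded π (≤-trans (m≤n+m _ (size p)) le)

  length≤weight : ∀ {π} → All (λ p → 1 ≤ size p) π → length π ≤ sum (map size π)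
  length≤weight []       = z≤n
  length≤weight (p ∷ ps) = +-mono-≤ p (length≤weight ps)

∈-overpartitions : ∀ n π → π ∈ overpartitions n ⇔ IsOverpartition n π
∈-overpartitions n π = mk⇔
  (λ π∈ → proj₂ (∈-filter⁻ (isOverpartition? n) {xs = words (partsUpTo n) n} π∈))
  (λ r → let open IsOverpartition r; w≤n = ≤-reflexive weight in
    ∈-filter⁺ (isOverpartition? n)
      (∈-words n (parts-bounded π w≤n) (≤-trans (length≤weight positive) w≤n)) r)

overpartitions-unique : ∀ n → Unique (overpartitions n)
overpartitions-unique n =
  Unique.filter⁺ (isOverpartition? n) (words-unique n (partsUpTo-unique n))

{-# OPTIONS --safe #-}
module Submission where

-- Toggling the overline of the first (largest) part is an involution on the
-- overpartitions with 1 ≤ SN π < size of the first part: it leaves SN unchanged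
-- and changes ℓ-O>N by one, so it exchanges the even and the odd ones. If the
-- first part is at most SN π, then ℓ-O>N π = 0 and every non-overlined part
-- equals SN π, so these overpartitions are all even, and they are exactly the
-- ones counted by H′-ON.

open import Defs
open import Data.Nat using (ℕ; _≥_)
open import Data.Integer using (+_; _-_)
open import Relation.Binary.PropositionalEquality using (_≡_)

open import Algebra.Bundles using (AbelianGroup)
open import Data.Integer.Properties using (+-0-abelianGroup)
open import Algebra.Properties.Group (AbelianGroup.group +-0-abelianGroup)
  using (//-rightDividesʳ)
open import Data.Bool using (true; false; not)
import Data.Bool.Properties as Bool
open import Data.List using (List; []; _∷_; _++_; map; filter; length)
open import Data.List.Extrema.Nat
  using (argmin-sel; min≤⊤; min≤xs; v≤min⁺; max≤v⁺; xs≤max)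
open import Data.List.Membership.Propositional using (_∈_)
open import Data.List.Membership.Propositional.Properties
  using (∈-map⁺; ∈-map⁻; ∈-++⁺ˡ; ∈-++⁺ʳ; ∈-++⁻; ∈-filter⁺; ∈-filter⁻)
open import Data.List.Membership.Propositional.Properties.WithK using (unique∧set⇒bag)
open import Data.List.Properties using (filter-accept; filter-none; length-map; length-++)
open import Data.List.Relation.Binary.BagAndSetEquality using (∼bag⇒↭)
open import Data.List.Relation.Binary.Permutation.Propositional.Properties using (↭-length)
open import Data.List.Relation.Unary.All using (All; []; _∷_)
import Data.List.Relation.Unary.All as All
import Data.List.Relation.Unary.All.Properties as All
open import Data.List.Relation.Unary.AllPairs using (_∷_)
open import Data.List.Relation.Unary.Linked using (Linked; [-]; _∷_)
open import Data.List.Relation.Unary.Linked.Properties using (Linked⇒All)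
open import Data.List.Relation.Unary.Unique.Propositional using (Unique)
import Data.List.Relation.Unary.Unique.Propositional.Properties as Unique
open import Data.Nat using (zero; suc; _+_; _≤_; _<_; z≤n)
open import Data.Nat.Divisibility using (_∣_; _∣?_; _∣0; ∣-refl; ∣m∣n⇒∣m+n; ∣m+n∣m⇒∣n; ∣1⇒≡1)
open import Data.Nat.Properties
  using ( _<?_; +-comm; ≤-refl; ≤-reflexive; ≤-trans; ≤-antisym; <⇒≤; <-irrefl; ≤⇒≯; ≮⇒≥
        ; <-≤-trans)
open import Data.Product using (_×_; _,_; proj₁; proj₂)
open import Data.Sum using (_⊎_; inj₁; inj₂)
open import Function using (_∘_; mk⇔; Equivalence)
open import Level using (0ℓ)
open import Relation.Binary.PropositionalEquality
  using (refl; sym; trans; cong; subst)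
open import Relation.Nullary using (¬_; yes; no; contradiction)
open import Relation.Unary using (Pred; Decidable)

-- The entries satisfying `Q`, followed by the `f`-images of those satisfying `R`, form a list with
-- the same members as the entries satisfying `P`. It has no duplicates, since an involution is
-- injective and no such image satisfies `Q`, so the two lists are permutations of each other.
length-filter-+ :
  ∀ {A : Set} {P Q R : Pred A 0ℓ} (P? : Decidable P) (Q? : Decidable Q) (R? : Decidable R)
  {xs : List A} (f : A → A) → (∀ x → f (f x) ≡ x) → (∀ {x} → x ∈ xs → f x ∈ xs) →
  (∀ {x} → x ∈ xs → Q x → P x) →
  (∀ {x} → x ∈ xs → R x → P (f x) × ¬ Q (f x)) →
  (∀ {x} → x ∈ xs → P x → Q x ⊎ R (f x)) →
  Unique xs → length (filter P? xs) ≡ length (filter Q? xs) + length (filter R? xs)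
length-filter-+ P? Q? R? {xs} f involutive closed Q⇒P R⇒P¬Q P⇒Q⊎R unique =
  trans (↭-length (∼bag⇒↭ (unique∧set⇒bag (Unique.filter⁺ P? unique) ++-unique (mk⇔ to from))))
        (trans (length-++ (filter Q? xs))
          (cong (λ k → length (filter Q? xs) + k) (length-map f (filter R? xs))))
  where
  disjoint : ∀ {x} → ¬ (x ∈ filter Q? xs × x ∈ map f (filter R? xs))
  disjoint (x∈Q , x∈fR) with ∈-map⁻ f x∈fR
  ... | y , y∈R , refl with ∈-filter⁻ R? {xs = xs} y∈R
  ... | y∈ , Ry = proj₂ (R⇒P¬Q y∈ Ry) (proj₂ (∈-filter⁻ Q? {xs = xs} x∈Q))

  ++-unique : Unique (filter Q? xs ++ map f (filter R? xs))
  ++-unique = Unique.++⁺ (Unique.filter⁺ Q? unique)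
    (Unique.map⁺ (λ {x} {y} fx≡fy → trans (sym (involutive x)) (trans (cong f fx≡fy) (involutive y)))
      (Unique.filter⁺ R? unique))
    disjoint

  to : ∀ {x} → x ∈ filter P? xs → x ∈ filter Q? xs ++ map f (filter R? xs)
  to {x} x∈P with ∈-filter⁻ P? {xs = xs} x∈P
  ... | x∈ , Px with P⇒Q⊎R x∈ Px
  ... | inj₁ Qx  = ∈-++⁺ˡ (∈-filter⁺ Q? x∈ Qx)
  ... | inj₂ Rfx = ∈-++⁺ʳ (filter Q? xs)
    (subst (_∈ _) (involutive x) (∈-map⁺ f (∈-filter⁺ R? (closed x∈) Rfx)))

  from : ∀ {x} → x ∈ filter Q? xs ++ map f (filter R? xs) → x ∈ filter P? xs
  from x∈ with ∈-++⁻ (filter Q? xs) x∈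
  ... | inj₁ x∈Q with ∈-filter⁻ Q? {xs = xs} x∈Q
  ...   | x∈xs , Qx = ∈-filter⁺ P? x∈xs (Q⇒P x∈xs Qx)
  from x∈ | inj₂ x∈fR with ∈-map⁻ f x∈fR
  ... | y , y∈R , refl with ∈-filter⁻ R? {xs = xs} y∈R
  ... | y∈ , Ry = ∈-filter⁺ P? (closed y∈) (proj₁ (R⇒P¬Q y∈ Ry))

2∣n⇒2∤1+n : ∀ {n} → 2 ∣ n → ¬ 2 ∣ suc n
2∣n⇒2∤1+n {n} 2∣n 2∣1+n with ∣1⇒≡1 (∣m+n∣m⇒∣n (subst (2 ∣_) (+-comm 1 n) 2∣1+n) 2∣n)
... | ()

2∤n⇒2∣1+n : ∀ n → ¬ 2 ∣ n → 2 ∣ suc n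
2∤n⇒2∣1+n zero          2∤n = contradiction (2 ∣0) 2∤n
2∤n⇒2∣1+n (suc zero)    _   = ∣-refl
2∤n⇒2∣1+n (suc (suc n)) 2∤n =
  ∣m∣n⇒∣m+n (∣-refl {2}) (2∤n⇒2∣1+n n (2∤n ∘ ∣m∣n⇒∣m+n (∣-refl {2})))

smallest-≤ : ∀ xs → All (smallest xs ≤_) xs
smallest-≤ []       = []
smallest-≤ (x ∷ xs) = min≤⊤ x xs ∷ min≤xs x xs

-- The bound `1 ≤ smallest xs` rules out the empty list, whose default value 0 would jump to `x`.
smallest-∷ : ∀ {x} xs → 1 ≤ smallest xs → smallest xs < x → smallest (x ∷ xs) ≡ smallest xs
smallest-∷ {x} (y ∷ ys) _ s<x = ≤-antisym
  (v≤min⁺ (All.head x≤) (All.tail x≤))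
  (v≤min⁺ (<⇒≤ s<x) (smallest-≤ (y ∷ ys)))
  where x≤ = min≤xs x (y ∷ ys)

-- Here the bound concerns the extended list: a minimum strictly below `x` must be attained in `xs`.
smallest-∷⁻ : ∀ {x} xs → smallest (x ∷ xs) < x → smallest (x ∷ xs) ≡ smallest xs
smallest-∷⁻ []       s<x = contradiction s<x (<-irrefl refl)
smallest-∷⁻ {x} (y ∷ ys) s<x with argmin-sel (λ z → z) x (y ∷ ys)
... | inj₁ s≡x = contradiction s<x (<-irrefl s≡x)
... | inj₂ s∈  = ≤-antisym
  (v≤min⁺ (All.head x≤) (All.tail x≤))
  (All.lookup (smallest-≤ (y ∷ ys)) s∈)
  where x≤ = min≤xs x (y ∷ ys)

-- The value 0 keeps the empty list out of the toggling domain `SN π < headSize π`.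
headSize : List Part → ℕ
headSize []      = 0
headSize (p ∷ π) = size p

toggle : List Part → List Part
toggle []      = []
toggle (p ∷ π) = part (size p) (not (overlined p)) ∷ π

toggle-involutive : ∀ π → toggle (toggle π) ≡ π
toggle-involutive []      = refl
toggle-involutive (p ∷ π) = cong (λ b → part (size p) b ∷ π) (Bool.not-involutive (overlined p))

headSize-toggle : ∀ π → headSize (toggle π) ≡ headSize π
headSize-toggle []      = refl
headSize-toggle (_ ∷ _) = refl

toggle-isOverpartition : ∀ {n π} → IsOverpartition n π → IsOverpartition n (toggle π)
toggle-isOverpartition {π = []}    r = r
toggle-isOverpartition {π = _ ∷ _} record
  -- `f` survives the toggle: it constrains the overlines of later parts only, never that of the
  -- head.
  { positive = p ∷ ps ; nonincreasing = ni ; firstOnly = f ∷ fs ; weight = w } = record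
  { positive = p ∷ ps ; nonincreasing = relink ni ; firstOnly = f ∷ fs ; weight = w }
  where
  relink : ∀ {p b π} → Linked (λ p q → size p ≥ size q) (p ∷ π) →
           Linked (λ p q → size p ≥ size q) (part (size p) b ∷ π)
  relink [-]     = [-]
  relink (x ∷ l) = x ∷ l

SN-∷ : ∀ {m} b π → 1 ≤ SN π → SN π < m → SN (part m b ∷ π) ≡ SN π
SN-∷ true  π _   _   = refl
SN-∷ false π 1≤s s<m = smallest-∷ (nonOverlinedSizes π) 1≤s s<m

SN-∷⁻ : ∀ {m} b π → SN (part m b ∷ π) < m → SN (part m b ∷ π) ≡ SN π
SN-∷⁻ true  π _   = refl
SN-∷⁻ false π s<m = smallest-∷⁻ (nonOverlinedSizes π) s<m

-- Either way the head does not affect `SN`, so both sides equal `SN` of the tail.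
SN-toggle : ∀ π → 1 ≤ SN π → SN π < headSize π → SN (toggle π) ≡ SN π
SN-toggle (part m b ∷ π) 1≤s s<m =
  trans (SN-∷ (not b) π (subst (1 ≤_) s≡ 1≤s) (subst (_< m) s≡ s<m)) (sym s≡)
  where s≡ = SN-∷⁻ b π s<m

ℓ-O>N-∷ : ∀ {m} π → 1 ≤ SN π → SN π < m →
          ℓ-O>N (part m true ∷ π) ≡ suc (ℓ-O>N (part m false ∷ π))
-- The overlined head passes the filter; the remaining counts agree once both thresholds are `SN π`.
ℓ-O>N-∷ π 1≤s s<m = trans (cong length (filter-accept (SN π <?_) s<m))
  (cong (λ s → suc (length (filter (s <?_) (overlinedSizes π)))) (sym (SN-∷ false π 1≤s s<m)))

ℓ-O>N-toggle : ∀ π → 1 ≤ SN π → SN π < headSize π →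
               ℓ-O>N (toggle π) ≡ suc (ℓ-O>N π) ⊎ ℓ-O>N π ≡ suc (ℓ-O>N (toggle π))
-- An overlined head is invisible to `SN`, so the hypotheses already speak of the tail.
ℓ-O>N-toggle (part m true  ∷ π) 1≤s s<m = inj₂ (ℓ-O>N-∷ π 1≤s s<m)
ℓ-O>N-toggle (part m false ∷ π) 1≤s s<m =
  inj₁ (ℓ-O>N-∷ π (subst (1 ≤_) s≡ 1≤s) (subst (_< m) s≡ s<m))
  where s≡ = SN-∷⁻ false π s<m

toggle-even⇒odd : ∀ π → 1 ≤ SN π → SN π < headSize π → 2 ∣ ℓ-O>N π → ¬ 2 ∣ ℓ-O>N (toggle π)
toggle-even⇒odd π 1≤s s<h e e′ with ℓ-O>N-toggle π 1≤s s<h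
... | inj₁ eq = 2∣n⇒2∤1+n e (subst (2 ∣_) eq e′)
... | inj₂ eq = 2∣n⇒2∤1+n e′ (subst (2 ∣_) eq e)

toggle-odd⇒even : ∀ π → 1 ≤ SN π → SN π < headSize π → ¬ 2 ∣ ℓ-O>N π → 2 ∣ ℓ-O>N (toggle π)
toggle-odd⇒even π 1≤s s<h o with ℓ-O>N-toggle π 1≤s s<h
... | inj₁ eq = subst (2 ∣_) (sym eq) (2∤n⇒2∣1+n _ o)
-- `ℓ-O>N π` is the larger count here, so an odd count after toggling would make it even, against
-- `o`.
... | inj₂ eq with 2 ∣? ℓ-O>N (toggle π)
...   | yes e  = e
...   | no  o′ = contradiction (subst (2 ∣_) (sym eq) (2∤n⇒2∣1+n _ o′)) o

LO≤SN⇒ℓ-O>N≡0 : ∀ π → LO π ≤ SN π → ℓ-O>N π ≡ 0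
LO≤SN⇒ℓ-O>N≡0 π LO≤SN = cong length (filter-none (SN π <?_)
  (All.map (λ t≤LO → ≤⇒≯ (≤-trans t≤LO LO≤SN)) (xs≤max 0 (overlinedSizes π))))

-- The head is itself overlined or non-overlined, hence bounded by `LO` or by `LN`. This keeps
-- toggled odd overpartitions out of `H′-ON`.
headSize≤ : ∀ {s} π → LO π ≤ s → LN π ≤ s → headSize π ≤ s
headSize≤ []                 _    _    = z≤n
headSize≤ (part m true  ∷ π) LO≤s _    = ≤-trans (All.head (xs≤max 0 (m ∷ overlinedSizes π))) LO≤s
headSize≤ (part m false ∷ π) _    LN≤s = ≤-trans (All.head (xs≤max 0 (m ∷ nonOverlinedSizes π))) LN≤s

sizes≤headSize : ∀ {n π} → IsOverpartition n π → All (λ p → size p ≤ headSize π) π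
sizes≤headSize {π = []}    _ = []
sizes≤headSize {π = p ∷ π} r =
  -- Starting the chain at `p` itself, by reflexivity, includes the head in the conclusion.
  Linked⇒All (λ q≤p r≤q → ≤-trans r≤q q≤p) {v = p} ≤-refl (IsOverpartition.nonincreasing r)

LO≤headSize : ∀ {n π} → IsOverpartition n π → LO π ≤ headSize π
LO≤headSize r = max≤v⁺ z≤n (All.map⁺ (All.filter⁺ _ (sizes≤headSize r)))

LN≤headSize : ∀ {n π} → IsOverpartition n π → LN π ≤ headSize π
LN≤headSize r = max≤v⁺ z≤n (All.map⁺ (All.filter⁺ _ (sizes≤headSize r)))

smallest≤largest : ∀ xs → smallest xs ≤ largest xs
smallest≤largest []       = z≤n
smallest≤largest (x ∷ xs) = ≤-trans (min≤⊤ x xs) (All.head (xs≤max 0 (x ∷ xs)))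

-- The even overpartitions are those counted by `H′-ON` together with the toggles of the odd ones.
A≡H′+B : ∀ n → A-O>N n ≡ H′-ON n + B-O>N n
A≡H′+B n = length-filter-+ _ _ _ toggle toggle-involutive
  (λ {π} π∈ → Equivalence.from (∈-overpartitions n (toggle π))
    (toggle-isOverpartition (isOverpartition π∈)))
  (λ {π} _ ((1≤s , LO≤s) , _) →
    1≤s , subst (2 ∣_) (sym (LO≤SN⇒ℓ-O>N≡0 π LO≤s)) (2 ∣0))
  odd⇒toggle-even
  even⇒H′⊎toggle-odd
  (overpartitions-unique n)
  where
  isOverpartition : ∀ {π} → π ∈ overpartitions n → IsOverpartition n π
  isOverpartition {π} = Equivalence.to (∈-overpartitions n π)

  odd⇒toggle-even : ∀ {π} → π ∈ overpartitions n → SN π ≥ 1 × ¬ 2 ∣ ℓ-O>N π →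
    (SN (toggle π) ≥ 1 × 2 ∣ ℓ-O>N (toggle π)) × ¬ (𝓔-ON (toggle π) × LN (toggle π) ≡ SN (toggle π))
  odd⇒toggle-even {π} π∈ (1≤s , o) with SN π <? headSize π
  ... | yes s<h = (subst (1 ≤_) (sym s≡) 1≤s , toggle-odd⇒even π 1≤s s<h o) , ¬H′
    where
    s≡ = SN-toggle π 1≤s s<h

    ¬H′ : ¬ (𝓔-ON (toggle π) × LN (toggle π) ≡ SN (toggle π))
    -- Membership would bound the head, whose size toggling preserves, by `SN (toggle π)`, which
    -- equals `SN π`.
    ¬H′ ((_ , LO≤s) , LN≡s) = <-irrefl refl (<-≤-trans (subst (_< headSize π) (sym s≡) s<h)
      (subst (_≤ SN (toggle π)) (headSize-toggle π) (headSize≤ (toggle π) LO≤s (≤-reflexive LN≡s))))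
  -- With the head at most `SN π`, the count `ℓ-O>N π` is 0, hence even.
  ... | no s≮h = contradiction
    (subst (2 ∣_) (sym (LO≤SN⇒ℓ-O>N≡0 π (≤-trans (LO≤headSize (isOverpartition π∈)) (≮⇒≥ s≮h)))) (2 ∣0)) o

  even⇒H′⊎toggle-odd : ∀ {π} → π ∈ overpartitions n → SN π ≥ 1 × 2 ∣ ℓ-O>N π →
    (𝓔-ON π × LN π ≡ SN π) ⊎ (SN (toggle π) ≥ 1 × ¬ 2 ∣ ℓ-O>N (toggle π))
  even⇒H′⊎toggle-odd {π} π∈ (1≤s , e) with SN π <? headSize π
  ... | yes s<h = inj₂ (subst (1 ≤_) (sym (SN-toggle π 1≤s s<h)) 1≤s , toggle-even⇒odd π 1≤s s<h e)
  -- The head now bounds all sizes by `SN π`, so `LN π` is squeezed to `SN π`.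
  ... | no  s≮h = inj₁
    ( (1≤s , ≤-trans (LO≤headSize r) (≮⇒≥ s≮h))
    , ≤-antisym (≤-trans (LN≤headSize r) (≮⇒≥ s≮h)) (smallest≤largest (nonOverlinedSizes π)))
    where r = isOverpartition π∈

theorem2p13 : (n : ℕ) → n ≥ 1 → + A-O>N n - + B-O>N n ≡ + H′-ON n
-- The embedding of a natural sum computes to the integer sum, leaving `(H′ + B) - B`.
theorem2p13 n _ rewrite A≡H′+B n = //-rightDividesʳ (+ B-O>N n) (+ H′-ON n)
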